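{- For every finite simple graph $G$, $\chi_s(G)\le \tau(G)$.
   Context: $\tau(G)$ denotes the number of vertices in a longest path of $G$. A star colouring of $G$ is a proper vertex colouring in which every path on four vertices uses at least three distinct colours; the star chromatic number $\chi_s(G)$ is the least number of colours in a star colouring of $G$. -}

module Defs where

open import Data.Fin.Base using (Fin; zero; suc; finToFun; funToFin)
open import Data.Fin.Properties as Fin
  using (any?; all?; injective⇒≤; finToFun-funToFin)
open import Data.List.Base
  using (List; []; _∷_; length; map; deduplicate; lookup)
open import Data.List.Properties using (filter-all; length-map; map-cong)
open import Data.List.Membership.Propositional.Properties using (∈-lookup)
import Data.List.Relation.Unary.All as All
open import Data.List.Relation.Unary.AllPairs using ([]; _∷_)
open import Data.List.Relation.Unary.Linked using (Linked; []; linked?)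
open import Data.List.Relation.Unary.Unique.DecPropositional using (unique?)
open import Data.List.Relation.Unary.Unique.Propositional using (Unique)
open import Data.List.Relation.Unary.Unique.Propositional.Properties using (map⁺)
open import Data.Nat.Base using (ℕ; zero; suc; _≤_; s≤s⁻¹)
open import Data.Nat.Properties as ℕ using (_≤?_; ≤-refl; ≤-reflexive; ≮⇒≥; anyUpTo?)
open import Data.Product.Base using (∃; _×_; _,_; proj₁; proj₂)
open import Function.Base using (id; _∘_)
open import Level using (0ℓ)
open import Relation.Binary.Core using (Rel)
open import Relation.Binary.Definitions using (Symmetric; Irreflexive; Decidable)
open import Relation.Binary.PropositionalEquality
  using (_≡_; _≢_; _≗_; refl; sym; trans; cong; subst)
open import Relation.Nullary.Decidable
  using (Dec; yes; no; map′; ¬?; _×-dec_; _→-dec_; decidable-stable)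
open import Relation.Nullary.Negation using (contradiction)
open import Relation.Unary using (Pred) renaming (Decidable to Decidable₁)

-- Classically decidability of _~_ is no restriction; here it makes χₛ and τ
-- definable as functions to ℕ.
record Graph : Set₁ where
  field
    order    : ℕ
    _~_      : Rel (Fin order) 0ℓ
    _~?_     : Decidable _~_
    ~-sym    : Symmetric _~_
    ~-irrefl : Irreflexive _≡_ _~_

  Vertex : Set
  Vertex = Fin order

record IsLeast (P : Pred ℕ 0ℓ) (k : ℕ) : Set where
  field
    holds   : P k
    minimal : ∀ {m} → P m → k ≤ m

record IsGreatest (P : Pred ℕ 0ℓ) (k : ℕ) : Set where
  field
    holds   : P k
    maximal : ∀ {m} → P m → m ≤ k

module _ (G : Graph) where
  open Graph G

  -- A path is the list of its vertices in order. The empty list counts, which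
  -- affects only the graph with no vertices (whose longest path has 0 vertices).
  IsPath : Pred (List Vertex) 0ℓ
  IsPath xs = Linked _~_ xs × Unique xs

  HasPath : Pred ℕ 0ℓ
  HasPath m = ∃ λ xs → length xs ≡ m × IsPath xs

  IsProperColouring : ∀ {k} → Pred (Vertex → Fin k) 0ℓ
  IsProperColouring c = ∀ {u v} → u ~ v → c u ≢ c v

  coloursOn : ∀ {k} → (Vertex → Fin k) → List Vertex → ℕ
  coloursOn c xs = length (deduplicate Fin._≟_ (map c xs))

  -- The four-vertex paths are subgraphs of G, not necessarily induced.
  IsStarColouring : ∀ {k} → Pred (Vertex → Fin k) 0ℓ
  IsStarColouring c =
    IsProperColouring c ×
    (∀ xs → length xs ≡ 4 → IsPath xs → 3 ≤ coloursOn c xs)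

  -- Colours may go unused; this does not change the least k.
  StarColourable : Pred ℕ 0ℓ
  StarColourable k = ∃ λ (c : Vertex → Fin k) → IsStarColouring c

private
  least : ∀ {P} → Decidable₁ P → ∀ n → P n → ∃ (IsLeast P)
  least {P} P? n pn = go n n ≤-refl pn
    where
    go : ∀ b k → k ≤ b → P k → ∃ (IsLeast P)
    go b k k≤b pk with anyUpTo? P? k
    ... | no ¬lower = k , record
      { holds = pk ; minimal = λ pm → ≮⇒≥ λ m<k → ¬lower (_ , m<k , pm) }
    go zero    k k≤b pk | yes (m , m<k , pm) with () ← ℕ.<-≤-trans m<k k≤b
    go (suc b) k k≤b pk | yes (m , m<k , pm) =
      go b m (s≤s⁻¹ (ℕ.<-≤-trans m<k k≤b)) pm

  greatest : ∀ {P} → Decidable₁ P → P 0 → ∀ b → (∀ {m} → P m → m ≤ b) →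
             ∃ (IsGreatest P)
  greatest P? p₀ zero    bound = 0 , record { holds = p₀ ; maximal = bound }
  greatest {P} P? p₀ (suc b) bound with P? (suc b)
  ... | yes p = suc b , record { holds = p ; maximal = bound }
  ... | no ¬p = greatest P? p₀ b λ pm →
    s≤s⁻¹ (ℕ.≤∧≢⇒< (bound pm) λ { refl → ¬p pm })

  anyList? : ∀ {n} {P : Pred (List (Fin n)) 0ℓ} → Decidable₁ P →
             ∀ m → Dec (∃ λ xs → length xs ≡ m × P xs)
  anyList? P? zero =
    map′ (λ p → [] , refl , p) (λ { ([] , refl , p) → p }) (P? [])
  anyList? P? (suc m) =
    map′ (λ { (x , xs , eq , p) → x ∷ xs , cong suc eq , p })
         (λ { (x ∷ xs , refl , p) → x , xs , refl , p })
         (any? λ x → anyList? (P? ∘ (x ∷_)) m)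

  allList? : ∀ {n} {P : Pred (List (Fin n)) 0ℓ} → Decidable₁ P →
             ∀ m → Dec (∀ xs → length xs ≡ m → P xs)
  allList? P? m =
    map′ (λ ¬∃ xs eq → decidable-stable (P? xs) λ ¬p → ¬∃ (xs , eq , ¬p))
         (λ { f (xs , eq , ¬p) → ¬p (f xs eq) })
         (¬? (anyList? (¬? ∘ P?) m))

  anyFunction? : ∀ {m k} {P : Pred (Fin m → Fin k) 0ℓ} →
                 (∀ {f g} → f ≗ g → P f → P g) → Decidable₁ P → Dec (∃ P)
  anyFunction? resp P? =
    map′ (λ { (i , p) → finToFun i , p })
         (λ { (f , p) → funToFin f , resp (sym ∘ finToFun-funToFin f) p })
         (any? (P? ∘ finToFun))

  deduplicate-unique : ∀ {n} {xs : List (Fin n)} → Unique xs →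
                       deduplicate Fin._≟_ xs ≡ xs
  deduplicate-unique [] = refl
  deduplicate-unique {xs = x ∷ xs} (x∉xs ∷ xs!)
    rewrite deduplicate-unique xs! =
    cong (x ∷_) (filter-all (¬? ∘ (x Fin.≟_)) x∉xs)

  lookup-injective : ∀ {n} {xs : List (Fin n)} → Unique xs →
                     ∀ i j → lookup xs i ≡ lookup xs j → i ≡ j
  lookup-injective (x∉xs ∷ xs!) zero    zero    eq = refl
  lookup-injective (x∉xs ∷ xs!) zero    (suc j) eq =
    contradiction eq (All.lookup x∉xs (∈-lookup j))
  lookup-injective (x∉xs ∷ xs!) (suc i) zero    eq =
    contradiction (sym eq) (All.lookup x∉xs (∈-lookup i))
  lookup-injective (x∉xs ∷ xs!) (suc i) (suc j) eq =
    cong suc (lookup-injective xs! i j eq)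

module _ (G : Graph) where
  open Graph G

  isPath? : Decidable₁ (IsPath G)
  isPath? xs = linked? _~?_ xs ×-dec unique? Fin._≟_ xs

  isProperColouring? : ∀ {k} → Decidable₁ (IsProperColouring G {k})
  isProperColouring? c =
    map′ (λ f {u} {v} → f u v) (λ f u v → f)
         (all? λ u → all? λ v → (u ~? v) →-dec ¬? (c u Fin.≟ c v))

  isStarColouring? : ∀ {k} → Decidable₁ (IsStarColouring G {k})
  isStarColouring? c =
    isProperColouring? c ×-dec
    allList? (λ xs → isPath? xs →-dec (3 ≤? coloursOn G c xs)) 4

  isStarColouring-resp : ∀ {k} {c d : Vertex → Fin k} → c ≗ d →
                         IsStarColouring G c → IsStarColouring G d
  isStarColouring-resp c≗d (proper , star) =
    (λ u~v du≡dv → proper u~v (trans (c≗d _) (trans du≡dv (sym (c≗d _))))) ,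
    λ xs eq path → subst (λ ys → 3 ≤ length (deduplicate Fin._≟_ ys))
                         (map-cong c≗d xs) (star xs eq path)

  id-isStarColouring : IsStarColouring G id
  id-isStarColouring =
    (λ { u~v refl → ~-irrefl refl u~v }) ,
    λ { xs eq (_ , xs!) → ℕ.≤-trans (ℕ.n≤1+n 3) (≤-reflexive (sym
      (trans (cong length (deduplicate-unique (map⁺ id xs!)))
             (trans (length-map id xs) eq)))) }

  leastStarColours : ∃ (IsLeast (StarColourable G))
  leastStarColours =
    least (λ k → anyFunction? isStarColouring-resp isStarColouring?)
          order (id , id-isStarColouring)

  longestPath : ∃ (IsGreatest (HasPath G))
  longestPath = greatest (anyList? isPath?) ([] , refl , [] , []) order bound
    where
    bound : ∀ {m} → HasPath G m → m ≤ order
    bound (xs , refl , _ , xs!) = injective⇒≤ (lookup-injective xs! _ _)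

  χₛ : ℕ
  χₛ = proj₁ leastStarColours

  τ : ℕ
  τ = proj₁ longestPath

{-# OPTIONS --safe #-}

-- For each vertex v let P v be the lexicographically least path ending at v.
-- If u ~ v, then one of P u, P v is a prefix of the other. Say P u ≤ P v. Either
-- P u followed by v is a path to v, or v is on P u and P u can be cut at v; in
-- both cases P v is at most an extension of P u, so it is one itself. Colour v
-- by the number of vertices preceding v on P v, which is less than τ. Vertices
-- whose paths are prefixes of P v then have distinct colours. In a path a b c d,
-- one of P b, P c is a prefix of the other; if P b is the shorter, then b and d
-- have distinct colours, and if P c is, then a and c do.
module Submission where

open import Data.Fin.Base using (Fin; fromℕ<)
open import Data.Fin.Properties as Fin using (fromℕ<-injective)
open import Data.List.Base
  using (List; []; _∷_; [_]; _++_; _∷ʳ_; length; map; filter; allFin;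
         cartesianProductWith; deduplicate)
import Data.List.Extrema as Extrema
open import Data.List.Membership.DecPropositional using (_∈?_)
open import Data.List.Membership.Propositional using (_∈_)
open import Data.List.Membership.Propositional.Properties
  using (∈-∃++; ∈-++⁻; ∈-++⁺ˡ; ∈-++⁺ʳ; ∈-allFin; ∈-filter⁺;
         ∈-cartesianProductWith⁺; ∈-deduplicate⁺)
open import Data.List.Properties
  using (++-assoc; ++-identityʳ; length-++-sucʳ; ∷-injectiveˡ; ∷-injectiveʳ)
import Data.List.Relation.Binary.Lex.NonStrict as Lex
open import Data.List.Relation.Binary.Subset.Propositional using (_⊆_)
open import Data.List.Relation.Unary.All as All using ([]; _∷_)
import Data.List.Relation.Unary.All.Properties as All
open import Data.List.Relation.Unary.AllPairs using ([]; _∷_)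
open import Data.List.Relation.Unary.Any using (here; there)
open import Data.List.Relation.Unary.Linked using (Linked; []; [-]; _∷_)
open import Data.List.Relation.Unary.Unique.Propositional using (Unique)
import Data.List.Relation.Unary.Unique.Propositional.Properties as Unique
open import Data.Nat.Base using (ℕ; zero; suc; _≤_; _<_; z≤n; s≤s; s≤s⁻¹)
import Data.Nat.Properties as ℕ
open import Data.Product.Base using (∃; _,_; proj₁; proj₂)
open import Data.Sum.Base using (_⊎_; inj₁; inj₂)
open import Level using (0ℓ)
open import Relation.Binary.Bundles using (DecTotalOrder)
open import Relation.Binary.Core using (Rel)
open import Relation.Binary.PropositionalEquality
  using (_≡_; _≢_; refl; sym; trans; cong; subst)
open import Relation.Nullary.Decidable using (yes; no)
open import Relation.Nullary.Negation using (contradiction)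
open import Defs using
  (Graph; IsLeast; IsGreatest; IsPath; IsStarColouring; coloursOn;
   isPath?; leastStarColours; longestPath; χₛ; τ)

module _ {A : Set} where

  -- Both `x` and `y` stand at position `length xs` of one list. For least paths this recovers the
  -- end vertex of a prefix from its length.
  ∷ʳ-prefix-injective : ∀ (xs ys : List A) {x y us vs} →
                        length xs ≡ length ys →
                        xs ∷ʳ x ++ us ≡ ys ∷ʳ y ++ vs → x ≡ y
  ∷ʳ-prefix-injective []       []       _  eq = ∷-injectiveˡ eq
  ∷ʳ-prefix-injective (_ ∷ xs) (_ ∷ ys) l≡ eq =
    ∷ʳ-prefix-injective xs ys (ℕ.suc-injective l≡) (∷-injectiveʳ eq)

  Linked-++⁻ˡ : ∀ {R : Rel A 0ℓ} xs {ys} → Linked R (xs ++ ys) → Linked R xs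
  Linked-++⁻ˡ []           _       = []
  Linked-++⁻ˡ (_ ∷ [])     _       = [-]
  Linked-++⁻ˡ (_ ∷ _ ∷ xs) (r ∷ l) = r ∷ Linked-++⁻ˡ (_ ∷ xs) l

  Linked-∷ʳ⁺ : ∀ {R : Rel A 0ℓ} xs {x y} → Linked R (xs ∷ʳ x) → R x y →
               Linked R (xs ∷ʳ x ∷ʳ y)
  Linked-∷ʳ⁺ []           [-]     r = r ∷ [-]
  Linked-∷ʳ⁺ (_ ∷ [])     (q ∷ l) r = q ∷ Linked-∷ʳ⁺ [] l r
  Linked-∷ʳ⁺ (_ ∷ _ ∷ xs) (q ∷ l) r = q ∷ Linked-∷ʳ⁺ (_ ∷ xs) l r

  Unique-++⁻ˡ : ∀ xs {ys : List A} → Unique (xs ++ ys) → Unique xs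
  Unique-++⁻ˡ []       _         = []
  Unique-++⁻ˡ (_ ∷ xs) (x∉ ∷ u!) = All.++⁻ˡ xs x∉ ∷ Unique-++⁻ˡ xs u!

  -- Pigeonhole by induction: delete one occurrence of `x` from `ys`; the tail `xs` still lies in
  -- what is left, because it avoids `x`.
  Unique-⊆⇒length-≤ : ∀ {xs ys : List A} → Unique xs → xs ⊆ ys →
                      length xs ≤ length ys
  Unique-⊆⇒length-≤ [] _ = z≤n
  Unique-⊆⇒length-≤ {x ∷ xs} (x∉xs ∷ xs!) xs⊆ys
    with as , bs , refl ← ∈-∃++ (xs⊆ys (here refl)) =
    subst (suc (length xs) ≤_) (sym (length-++-sucʳ as x bs))
          (s≤s (Unique-⊆⇒length-≤ xs! avoid))
    where
    avoid : xs ⊆ as ++ bs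
    avoid y∈xs with ∈-++⁻ as (xs⊆ys (there y∈xs))
    ... | inj₁ y∈as         = ∈-++⁺ˡ y∈as
    ... | inj₂ (here refl)  = contradiction refl (All.lookup x∉xs y∈xs)
    ... | inj₂ (there y∈bs) = ∈-++⁺ʳ as y∈bs

module _ {n : ℕ} where

  open DecTotalOrder (Lex.≤-decTotalOrder (Fin.≤-decTotalOrder n))
    using () renaming (_≤_ to _≤ₗ_)

  ≤ₗ-++ʳ : ∀ xs {ys} → xs ≤ₗ xs ++ ys
  ≤ₗ-++ʳ []       {[]}    = Lex.base _
  ≤ₗ-++ʳ []       {_ ∷ _} = Lex.halt
  ≤ₗ-++ʳ (_ ∷ xs)         = Lex.next refl (≤ₗ-++ʳ xs)

  -- At a first disagreement within `xs`, the two bounds would order the entries strictly in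
  -- opposite directions; and `ys` cannot stop inside `xs`, as a proper prefix is smaller.
  ≤ₗ-between-extension : ∀ {xs ys} zs → xs ≤ₗ ys → ys ≤ₗ xs ++ zs →
                         ∃ λ ws → xs ++ ws ≡ ys
  ≤ₗ-between-extension {[]}    {ys}    _  _ _ = ys , refl
  ≤ₗ-between-extension {_ ∷ _} {_ ∷ _} _  (Lex.this (x≤y , x≢y))
                                          (Lex.this (y≤x , _)) =
    contradiction (Fin.≤-antisym x≤y y≤x) x≢y
  ≤ₗ-between-extension {_ ∷ _} {_ ∷ _} _  (Lex.this (_ , x≢y)) (Lex.next y≡x _) =
    contradiction (sym y≡x) x≢y
  ≤ₗ-between-extension {_ ∷ _} {_ ∷ _} _  (Lex.next x≡y _) (Lex.this (_ , y≢x)) =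
    contradiction (sym x≡y) y≢x
  ≤ₗ-between-extension {_ ∷ _} {_ ∷ _} zs (Lex.next refl xs≤) (Lex.next _ ys≤)
    with ws , refl ← ≤ₗ-between-extension zs xs≤ ys≤ = ws , refl

  -- With two letters or more the lexicographic order has infinite descending chains; the length
  -- bound leaves a finite set to minimise over.
  listsUpTo : ℕ → List (List (Fin n))
  listsUpTo zero    = [ [] ]
  listsUpTo (suc m) = [] ∷ cartesianProductWith _∷_ (allFin n) (listsUpTo m)

  ∈-listsUpTo : ∀ {m} xs → length xs ≤ m → xs ∈ listsUpTo m
  ∈-listsUpTo {zero}  []       _ = here refl
  ∈-listsUpTo {suc _} []       _ = here refl
  ∈-listsUpTo {suc _} (x ∷ xs) l =
    there (∈-cartesianProductWith⁺ _∷_ (∈-allFin x) (∈-listsUpTo xs (s≤s⁻¹ l)))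

  3≤length-deduplicate : ∀ {x y z : Fin n} xs → x ≢ y → x ≢ z → y ≢ z →
                         x ∷ y ∷ z ∷ [] ⊆ xs →
                         3 ≤ length (deduplicate Fin._≟_ xs)
  3≤length-deduplicate _ x≢y x≢z y≢z sub =
    Unique-⊆⇒length-≤ ((x≢y ∷ x≢z ∷ []) ∷ (y≢z ∷ []) ∷ [] ∷ [])
                      (λ p → ∈-deduplicate⁺ Fin._≟_ (sub p))

module _ (G : Graph) where
  open Graph G
  open DecTotalOrder (Lex.≤-decTotalOrder (Fin.≤-decTotalOrder order))
    using (totalOrder; total) renaming (_≤_ to _≤ₗ_; trans to ≤ₗ-trans)
  open Extrema totalOrder using (argmin; argmin-all; f[argmin]≤f[xs])

  IsPath-++⁻ˡ : ∀ xs {ys} → IsPath G (xs ++ ys) → IsPath G xs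
  IsPath-++⁻ˡ xs (l , u!) = Linked-++⁻ˡ xs l , Unique-++⁻ˡ xs u!

  length<τ : ∀ {v} xs → IsPath G (xs ∷ʳ v) → length xs < τ G
  length<τ {v} xs p =
    IsGreatest.maximal (proj₂ (longestPath G)) (xs ∷ʳ v , length-∷ʳ , p)
    where
    length-∷ʳ : length (xs ∷ʳ v) ≡ suc (length xs)
    length-∷ʳ = trans (length-++-sucʳ xs v [])
                      (cong (λ ys → suc (length ys)) (++-identityʳ xs))

  candidates : Vertex → List (List Vertex)
  candidates v = filter (λ xs → isPath? G (xs ∷ʳ v)) (listsUpTo (τ G))

  -- The end vertex is left off, so that the length of the stem is its position on the path; it is
  -- put back for the comparison. The default `[]` stands for the one-vertex path.
  stem : Vertex → List Vertex
  stem v = argmin (_∷ʳ v) [] (candidates v)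

  leastPath : Vertex → List Vertex
  leastPath v = stem v ∷ʳ v

  leastPath-isPath : ∀ v → IsPath G (leastPath v)
  leastPath-isPath v =
    argmin-all (_∷ʳ v) {P = λ xs → IsPath G (xs ∷ʳ v)} ([-] , [] ∷ [])
               (All.all-filter (λ xs → isPath? G (xs ∷ʳ v)) (listsUpTo (τ G)))

  leastPath-least : ∀ {v} xs → IsPath G (xs ∷ʳ v) → leastPath v ≤ₗ xs ∷ʳ v
  leastPath-least {v} xs p =
    All.lookup (f[argmin]≤f[xs] {f = _∷ʳ v} [] (candidates v))
      (∈-filter⁺ (λ xs → isPath? G (xs ∷ʳ v))
                 -- No path is lost to the length bound, since stems are shorter than `τ G`.
                 (∈-listsUpTo xs (ℕ.<⇒≤ (length<τ xs p))) p)

  _⊑_ : Rel Vertex 0ℓ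
  u ⊑ v = ∃ λ ws → leastPath u ++ ws ≡ leastPath v

  ⊑-refl : ∀ {v} → v ⊑ v
  ⊑-refl = [] , ++-identityʳ _

  ⊑-trans : ∀ {u v w} → u ⊑ v → v ⊑ w → u ⊑ w
  ⊑-trans {u} (as , eq₁) (bs , eq₂) = as ++ bs ,
    trans (sym (++-assoc (leastPath u) as bs)) (trans (cong (_++ bs) eq₁) eq₂)

  ~⇒≤ₗ-extension : ∀ {u v} → u ~ v → ∃ λ zs → leastPath v ≤ₗ leastPath u ++ zs
  ~⇒≤ₗ-extension {u} {v} u~v with _∈?_ Fin._≟_ v (leastPath u)
  ... | no v∉ = [ v ] , leastPath-least (leastPath u)
    ( Linked-∷ʳ⁺ (stem u) (proj₁ (leastPath-isPath u)) u~v
    , Unique.++⁺ (proj₂ (leastPath-isPath u)) ([] ∷ [])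
                 λ { (v∈ , here refl) → v∉ v∈ } )
  -- The cut path is a prefix of `leastPath u`, hence lexicographically at most `leastPath u`
  -- itself, so `zs` can be empty.
  ... | yes v∈ with as , bs , eq ← ∈-∃++ v∈ = [] ,
    subst (leastPath v ≤ₗ_) (sym eq′) (≤ₗ-trans
      (leastPath-least as
        (IsPath-++⁻ˡ (as ∷ʳ v) (subst (IsPath G) eq″ (leastPath-isPath u))))
      (≤ₗ-++ʳ (as ∷ʳ v)))
    where
    eq″ : leastPath u ≡ as ∷ʳ v ++ bs
    eq″ = trans eq (sym (++-assoc as [ v ] bs))
    eq′ : leastPath u ++ [] ≡ as ∷ʳ v ++ bs
    eq′ = trans (++-identityʳ _) eq″

  -- The smaller least path and an extension of it enclose the larger one.
  ~⇒⊑⊎⊒ : ∀ {u v} → u ~ v → u ⊑ v ⊎ v ⊑ u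
  ~⇒⊑⊎⊒ {u} {v} u~v with total (leastPath u) (leastPath v)
  ... | inj₁ u≤v = let zs , v≤ = ~⇒≤ₗ-extension u~v in
    inj₁ (≤ₗ-between-extension zs u≤v v≤)
  ... | inj₂ v≤u = let zs , u≤ = ~⇒≤ₗ-extension (~-sym u~v) in
    inj₂ (≤ₗ-between-extension zs v≤u u≤)

  colour : Vertex → Fin (τ G)
  colour v = fromℕ< (length<τ (stem v) (leastPath-isPath v))

  -- A colour is the length of a stem, so equal colours put `u` and `v` at the same position of
  -- `leastPath w`.
  ⊑-colour-injective : ∀ {u v w} → u ⊑ w → v ⊑ w → colour u ≡ colour v → u ≡ v
  ⊑-colour-injective {u} {v} (_ , eq₁) (_ , eq₂) cu≡cv =
    ∷ʳ-prefix-injective (stem u) (stem v) (fromℕ<-injective _ _ _ _ cu≡cv)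
                        (trans eq₁ (sym eq₂))

  colour-proper : ∀ {u v} → u ~ v → colour u ≢ colour v
  colour-proper u~v cu≡cv with ~⇒⊑⊎⊒ u~v
  ... | inj₁ u⊑v = ~-irrefl (⊑-colour-injective u⊑v ⊑-refl cu≡cv) u~v
  ... | inj₂ v⊑u = ~-irrefl (⊑-colour-injective ⊑-refl v⊑u cu≡cv) u~v

  -- The longer of `leastPath v` and `leastPath w` extends both `leastPath u` and `leastPath v`.
  common-neighbour-colour-injective : ∀ {u v w} → u ⊑ w → v ~ w →
                                      colour u ≡ colour v → u ≡ v
  common-neighbour-colour-injective u⊑w v~w cu≡cv with ~⇒⊑⊎⊒ v~w
  ... | inj₁ v⊑w = ⊑-colour-injective u⊑w v⊑w cu≡cv
  ... | inj₂ w⊑v = ⊑-colour-injective (⊑-trans u⊑w w⊑v) ⊑-refl cu≡cv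

  colour-isStarColouring : IsStarColouring G colour
  colour-isStarColouring = colour-proper , star
    where
    star : ∀ xs → length xs ≡ 4 → IsPath G xs → 3 ≤ coloursOn G colour xs
    star xs@(a ∷ b ∷ c ∷ d ∷ []) _
         ( a~b ∷ b~c ∷ c~d ∷ [-]
         , (_ ∷ a≢c ∷ _ ∷ []) ∷ (_ ∷ b≢d ∷ []) ∷ _ ) with ~⇒⊑⊎⊒ b~c
    -- The last three colours are distinct: `b` and `d` are separated through their common neighbour
    -- `c`.
    ... | inj₁ b⊑c = 3≤length-deduplicate (map colour xs)
      (colour-proper b~c)
      (λ eq → b≢d (common-neighbour-colour-injective b⊑c (~-sym c~d) eq))
      (colour-proper c~d) there
    -- Symmetrically, `a` and `c` are separated through `b`; `∈-++⁺ˡ` embeds the first three colours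
    -- in the list of four.
    ... | inj₂ c⊑b = 3≤length-deduplicate (map colour xs)
      (colour-proper a~b)
      (λ eq → a≢c (sym (common-neighbour-colour-injective c⊑b a~b (sym eq))))
      (colour-proper b~c) ∈-++⁺ˡ

theorem3p1 : (G : Graph) → χₛ G ≤ τ G
theorem3p1 G =
  IsLeast.minimal (proj₂ (leastStarColours G)) (colour G , colour-isStarColouring G)
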